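{- Let $G$ be a countably infinite group with identity $e$ such that for each $g\in G\setminus\{e\}$ the set $\{x\in G:x^2=g\}$ is finite. Then there exists a subset $A\subseteq G$ such that $A\supsetneq\Delta(A)\supsetneq\Delta^2(A)\supsetneq\Delta^3(A)\supsetneq\cdots$.
   Context: For $A\subseteq G$, $\Delta(A)=\{g\in G:|gA\cap A|=\infty\}$, and $\Delta^{k+1}(A)=\Delta(\Delta^k(A))$ with $\Delta^1=\Delta$. -}

module Defs where

open import Level using (Level; _⊔_)
open import Algebra.Bundles using (Group)
open import Data.List using (List)
open import Data.List.Relation.Unary.Any using (Any)
open import Data.Product using (Σ; ∃; _×_)
open import Data.Nat using (ℕ; zero; suc)
open import Relation.Nullary using (¬_)
open import Relation.Binary.PropositionalEquality as P using (_≡_)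
open import Function.Bundles using (Bijection)

module GroupDefs {c ℓ : Level} (G : Group c ℓ) where
  open Group G

  SubsetG : Set _
  SubsetG = Carrier → Set (c ⊔ ℓ)

  Respects≈ : SubsetG → Set _
  Respects≈ A = ∀ {x y} → x ≈ y → A x → A y

  Finite : SubsetG → Set _
  Finite S = Σ (List Carrier) λ xs → ∀ x → S x → Any (x ≈_) xs

  Infinite : SubsetG → Set _
  Infinite S = ¬ Finite S

  translateMeet : Carrier → SubsetG → SubsetG
  translateMeet g A x = A (g ⁻¹ ∙ x) × A x

  Δ : SubsetG → SubsetG
  Δ A g = Infinite (translateMeet g A)

  Δ^ : ℕ → SubsetG → SubsetG
  Δ^ zero A = A
  Δ^ (suc k) A = Δ (Δ^ k A)

  _⊆_ : SubsetG → SubsetG → Set _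
  A ⊆ B = ∀ x → A x → B x

  _⊊_ : SubsetG → SubsetG → Set _
  B ⊊ A = (B ⊆ A) × ∃ λ x → A x × ¬ B x

  CountablyInfinite : Set _
  CountablyInfinite = Bijection (P.setoid ℕ) setoid

  FiniteSquareRoots : Set _
  FiniteSquareRoots = ∀ g → ¬ (g ≈ ε) → Finite (λ x → Level.Lift (c ⊔ ℓ) (x ∙ x ≈ g))

{-# OPTIONS --safe #-}

-- Build finite blocks B t = {x, gx, x⁻¹, (gx)⁻¹}, each with a level j, where g = target t
-- is either ε or lies in an earlier block of level > j, and every such pair (j , g)
-- recurs infinitely often.  Let D k consist of ε and the blocks of level ≥ k.  If
-- x = point t is generic with respect to the first t elements h of G and the earlier
-- blocks, then a product h of two elements of D k involving a late block comes from a
-- single block and is one of ε, g, g⁻¹.  Hence Δ (D k) = D (k + 1).  The equations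
-- x x = h, x g x = h, ... have finitely many solutions x by the hypothesis on square
-- roots, apart from cases where h is ε, g or g⁻¹.  The equation x⁻¹ g x = h may have
-- infinitely many, but then the centraliser of g is infinite and x can be taken in it.

module Submission where

open import Defs
open import Level using (Level; _⊔_; lift)
open import Algebra.Bundles using (Group)
open import Data.Nat using (ℕ; zero; suc; _+_; _≤_; _<_; z≤n; s≤s; _≤?_)
  renaming (_⊔_ to _⊔ℕ_)
open import Data.Nat.Properties
  using (≤-refl; ≤-reflexive; ≤-trans; +-identityʳ; +-suc; suc-injective; m≤n+m; m≤m⊔n; m≤n⊔m;
         m≤n⇒m<n∨m≡n; n≤1+n; <-irrefl; <-cmp; n≤0⇒n≡0)
  renaming (_≟_ to _≟ℕ_)
open import Data.List using (List; []; _∷_; _++_; map; applyUpTo)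
open import Data.List.Extrema.Nat using (max; xs≤max)
open import Data.List.Relation.Unary.All as All using (All; []; _∷_)
import Data.List.Relation.Unary.All.Properties as All
open import Data.List.Relation.Unary.Any as Any using (here; there)
import Data.List.Relation.Unary.Any.Properties as Any
import Data.List.Membership.DecSetoid as DecMembership
import Data.List.Membership.Setoid.Properties as Membership
import Algebra.Properties.Group as GroupProperties
open import Data.Product using (Σ; ∃; _×_; _,_; proj₁; proj₂)
open import Data.Sum using (_⊎_; inj₁; inj₂)
open import Data.Empty using (⊥-elim)
open import Function using (_∘_)
open import Function.Bundles using (module Bijection)
open import Relation.Binary using (DecSetoid; tri<; tri≈; tri>)
open import Relation.Binary.PropositionalEquality as P using (_≡_)
open import Relation.Nullary using (¬_; Dec; yes; no; contradiction)
open import Relation.Nullary.Decidable using (map′; decidable-stable)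
import Relation.Binary.Reasoning.Setoid as SetoidReasoning

-- Enumerating pairs

next : ℕ × ℕ → ℕ × ℕ
next (zero  , b) = suc b , zero
next (suc a , b) = a , suc b

unpair : ℕ → ℕ × ℕ
unpair zero    = zero , zero
unpair (suc t) = next (unpair t)

-- `next` walks the diagonals. Stepping back lowers `b`, or moves to the preceding diagonal once `b`
-- is zero, so the recursion descends lexicographically in `s` and `b`.
unpair-onto-diagonal : ∀ s b a → a + b ≡ s → ∃ λ t → unpair t ≡ (a , b)
unpair-onto-diagonal s zero zero _ = zero , P.refl
unpair-onto-diagonal (suc s) zero (suc a) eq =
  let t , u = unpair-onto-diagonal s a zero (P.trans (P.sym (+-identityʳ a)) (suc-injective eq))
  in suc t , P.cong next u
unpair-onto-diagonal s (suc b) a eq =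
  let t , u = unpair-onto-diagonal s b (suc a) (P.trans (P.sym (+-suc a b)) eq)
  in suc t , P.cong next u

sum-next : ∀ p → proj₁ (next p) + proj₂ (next p) ≤ suc (proj₁ p + proj₂ p)
sum-next (zero  , b) = ≤-reflexive (P.cong suc (+-identityʳ b))
sum-next (suc a , b) = ≤-trans (≤-reflexive (+-suc a b)) (n≤1+n _)

sum-unpair : ∀ t → proj₁ (unpair t) + proj₂ (unpair t) ≤ t
sum-unpair zero    = z≤n
sum-unpair (suc t) = ≤-trans (sum-next (unpair t)) (s≤s (sum-unpair t))

-- The second coordinate of the outer pair is padding: it makes every pair occur at arbitrarily late
-- stages.
schedule : ℕ → ℕ × ℕ
schedule t = unpair (proj₁ (unpair t))

schedule-recurs : ∀ p N → ∃ λ t → N ≤ t × schedule t ≡ p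
schedule-recurs (j , n) N with unpair-onto-diagonal _ n j P.refl
... | m , m↦jn with unpair-onto-diagonal _ N m P.refl
...   | t , t↦mN =
  t
  , ≤-trans (m≤n+m N m) (P.subst (λ p → proj₁ p + proj₂ p ≤ t) t↦mN (sum-unpair t))
  , P.trans (P.cong (unpair ∘ proj₁) t↦mN) m↦jn

module Construction {c ℓ : Level} (G : Group c ℓ)
  (enum : GroupDefs.CountablyInfinite G) (roots : GroupDefs.FiniteSquareRoots G) where

  open Group G
  open GroupDefs G
  open GroupProperties G

  -- Decidable equality and finite lists from the enumeration

  e : ℕ → Carrier
  e = Bijection.to enum

  index : Carrier → ℕ
  index x = proj₁ (Bijection.strictlySurjective enum x)

  e-index : ∀ x → e (index x) ≈ x
  e-index x = proj₂ (Bijection.strictlySurjective enum x)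

  index-e : ∀ {n x} → e n ≈ x → index x ≡ n
  index-e {x = x} eq = Bijection.injective enum (trans (e-index x) (sym eq))

  _≟_ : ∀ x y → Dec (x ≈ y)
  x ≟ y = map′
    (λ eq → trans (sym (e-index x)) (trans (reflexive (P.cong e eq)) (e-index y)))
    (λ x≈y → P.sym (index-e (trans (e-index x) x≈y)))
    (index x ≟ℕ index y)

  decSetoid : DecSetoid c ℓ
  decSetoid = record { isDecEquivalence = record { isEquivalence = isEquivalence ; _≟_ = _≟_ } }

  open DecMembership decSetoid using (_∈_; _∉_; _∈?_)

  ∈-resp : ∀ {x y xs} → x ≈ y → x ∈ xs → y ∈ xs
  ∈-resp = Membership.∈-resp-≈ setoid

  bound : List Carrier → ℕ
  bound xs = suc (max 0 (map index xs))

  index<bound : ∀ {x xs} → x ∈ xs → index x < bound xs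
  index<bound {xs = xs} = All.lookupₛ setoid
    (λ x≈y → P.subst (_< bound xs) (P.sym (index-e (trans (e-index _) x≈y))))
    (All.map s≤s (All.map⁻ (xs≤max 0 (map index xs))))

  initial : ℕ → List Carrier
  initial = applyUpTo e

  ∈-initial : ∀ {h t} → index h < t → h ∈ initial t
  ∈-initial = Any.applyUpTo⁺ e (sym (e-index _))

  -- Cofinite conditions

  -- The exceptions are an explicit list, possibly too large, so that finitely many conditions merge
  -- by concatenation.
  Cofinite : ∀ {q} → (Carrier → Set q) → Set _
  Cofinite Q = Σ (List Carrier) λ F → ∀ {x} → x ∉ F → Q x

  module _ {p q} {P : Carrier → Set p} {Q : Carrier → Set q} where

    cofinite-× : Cofinite P → Cofinite Q → Cofinite (λ x → P x × Q x)
    cofinite-× (E , p) (F , q) = E ++ F , λ x∉ → p (x∉ ∘ Any.++⁺ˡ) , q (x∉ ∘ Any.++⁺ʳ E)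

  cofinite-All : ∀ {q} {Q : Carrier → Carrier → Set q} → (∀ h → Cofinite (Q h)) →
                 ∀ hs → Cofinite (λ x → All (λ h → Q h x) hs)
  cofinite-All q []       = [] , λ _ → []
  cofinite-All q (h ∷ hs) =
    let F , r = cofinite-× (q h) (cofinite-All q hs) in
    F , λ x∉ → proj₁ (r x∉) ∷ proj₂ (r x∉)

  cofinite-∘ : ∀ {q} {Q : Carrier → Set q} (f f⁻ : Carrier → Carrier) →
               (∀ {x y} → f x ≈ y → x ≈ f⁻ y) → Cofinite Q → Cofinite (Q ∘ f)
  cofinite-∘ f f⁻ adj (F , q) = map f⁻ F , λ x∉ → q (x∉ ∘ Any.map⁺ ∘ Any.map adj)

  cofinite-∙ : ∀ {q} {Q : Carrier → Set q} g → Cofinite Q → Cofinite (Q ∘ (g ∙_))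
  cofinite-∙ g = cofinite-∘ (g ∙_) (g ⁻¹ ∙_) (y≈x\\z g _ _)

  cofinite-⁻¹ : ∀ {q} {Q : Carrier → Set q} → Cofinite Q → Cofinite (Q ∘ _⁻¹)
  cofinite-⁻¹ = cofinite-∘ _⁻¹ _⁻¹ (λ eq → sym (⁻¹-selfInverse eq))

  -- The escape `h ≈ ε` allows for infinitely many square roots of `ε`; it is harmless because `ε`
  -- lies in every `D k`.
  Unsquare : Carrier → Carrier → Set ℓ
  Unsquare h x = x ∙ x ≈ h → h ≈ ε

  unsquare-cofinite : ∀ h → Cofinite (Unsquare h)
  unsquare-cofinite h with h ≟ ε
  ... | yes h≈ε = [] , λ _ _ → h≈ε
  ... | no  h≉ε = proj₁ (roots h h≉ε) , λ x∉ eq → contradiction (proj₂ (roots h h≉ε) _ (lift eq)) x∉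

  Apart : List Carrier → List Carrier → Carrier → Set (c ⊔ ℓ)
  Apart P H y = All (λ h → All (λ z → ¬ (y ∙ z ≈ h) × ¬ (z ∙ y ≈ h)) P) H

  apart-cofinite : ∀ P H → Cofinite (Apart P H)
  apart-cofinite P = cofinite-All λ h → cofinite-All (λ z → cofinite-×
    (h // z ∷ [] , λ y∉ eq → y∉ (here (x≈z//y _ z h eq)))
    (z \\ h ∷ [] , λ y∉ eq → y∉ (here (y≈x\\z z _ h eq)))) P

  -- Points outside finite lists, and conjugation

  fresh : ∀ xs → ∃ λ x → x ∉ xs
  fresh xs = e (bound xs) , λ x∈ → <-irrefl (index-e refl) (index<bound x∈)

  -- An element centralising `g` satisfies `Unconjugate` for every `h` at once; the quotient of two
  -- conjugators with the same result is such an element.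
  conj-quotient : ∀ {g h x y} → x ⁻¹ ∙ (g ∙ x) ≈ h → y ⁻¹ ∙ (g ∙ y) ≈ h →
                  (y ∙ x ⁻¹) ⁻¹ ∙ (g ∙ (y ∙ x ⁻¹)) ≈ g
  conj-quotient {g} {h} {x} {y} xh yh = begin
    (y ∙ x ⁻¹) ⁻¹ ∙ (g ∙ (y ∙ x ⁻¹))  ≈⟨ ∙-cong (⁻¹-anti-homo-// y x) (sym (assoc g y _)) ⟩
    (x ∙ y ⁻¹) ∙ ((g ∙ y) ∙ x ⁻¹)      ≈⟨ assoc x _ _ ⟩
    x ∙ (y ⁻¹ ∙ ((g ∙ y) ∙ x ⁻¹))      ≈⟨ ∙-congˡ (assoc _ _ _) ⟨
    x ∙ ((y ⁻¹ ∙ (g ∙ y)) ∙ x ⁻¹)      ≈⟨ ∙-congˡ (∙-congʳ (trans yh (sym xh))) ⟩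
    x ∙ ((x ⁻¹ ∙ (g ∙ x)) ∙ x ⁻¹)      ≈⟨ ∙-congˡ (assoc _ _ _) ⟩
    x ∙ (x ⁻¹ ∙ ((g ∙ x) ∙ x ⁻¹))      ≈⟨ \\-leftDividesˡ x _ ⟩
    (g ∙ x) ∙ x ⁻¹                      ≈⟨ //-rightDividesʳ x g ⟩
    g                                   ∎
    where open SetoidReasoning setoid

  Unconjugate : Carrier → Carrier → Carrier → Set ℓ
  Unconjugate g x h = x ⁻¹ ∙ (g ∙ x) ≈ h → h ≈ g

  -- Each h ∈ H is avoided by a second choice: if x and y both conjugate g to h,
  -- then y ∙ x ⁻¹ centralises g, and it lies outside F since y lies outside F ∙ x.
  fresh-unconjugate : ∀ g H F → ∃ λ x → x ∉ F × All (Unconjugate g x) H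
  fresh-unconjugate g []      F = proj₁ (fresh F) , proj₂ (fresh F) , []
  fresh-unconjugate g (h ∷ H) F with fresh-unconjugate g H F
  ... | x , x∉F , x-ok with (x ⁻¹ ∙ (g ∙ x)) ≟ h
  ...   | no x≁h = x , x∉F , ⊥-elim ∘ x≁h ∷ x-ok
  ...   | yes x∼h with fresh-unconjugate g H (F ++ map (_∙ x) F)
  ...     | y , y∉ , y-ok with (y ⁻¹ ∙ (g ∙ y)) ≟ h
  ...       | no y≁h = y , y∉ ∘ Any.++⁺ˡ , ⊥-elim ∘ y≁h ∷ y-ok
  ...       | yes y∼h =
    y ∙ x ⁻¹
    , (λ ∈F → y∉ (Any.++⁺ʳ F (Any.map⁺ (Any.map
        (λ eq → trans (sym (//-rightDividesˡ x y)) (∙-congʳ eq)) ∈F))))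
    , All.universal (λ _ eq → trans (sym eq) (conj-quotient x∼h y∼h)) (h ∷ H)

  -- Blocks

  -- The pair `x`, `g ∙ x` makes `g` a quotient of two block elements. Closure under inverses turns
  -- quotients into products, so only equations `y ∙ z ≈ h` need study.
  block : Carrier → Carrier → List Carrier
  block g x = x ∷ g ∙ x ∷ x ⁻¹ ∷ (g ∙ x) ⁻¹ ∷ []

  block-⁻¹ : ∀ {g x y} → y ∈ block g x → y ⁻¹ ∈ block g x
  block-⁻¹ (here eq)                         = there (there (here (⁻¹-cong eq)))
  block-⁻¹ (there (here eq))                 = there (there (there (here (⁻¹-cong eq))))
  block-⁻¹ (there (there (here eq)))         = here (trans (⁻¹-cong eq) (⁻¹-involutive _))
  block-⁻¹ (there (there (there (here eq)))) = there (here (trans (⁻¹-cong eq) (⁻¹-involutive _)))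

  -- These products occur for every choice of `x`: they come from `x x⁻¹`, `(g x) x⁻¹` and
  -- `x (g x)⁻¹`.
  Trivial : Carrier → Carrier → Set (c ⊔ ℓ)
  Trivial g h = h ∈ ε ∷ g ∷ g ⁻¹ ∷ []

  trivial-⁻¹ : ∀ {g h} → Trivial g (h ⁻¹) → Trivial g h
  trivial-⁻¹ (here eq)                 = here (trans (sym (⁻¹-selfInverse eq)) ε⁻¹≈ε)
  trivial-⁻¹ (there (here eq))         = there (there (here (sym (⁻¹-selfInverse eq))))
  trivial-⁻¹ (there (there (here eq))) = there (here (⁻¹-injective eq))

  -- Solving x ∙ x, gx ∙ gx, x ∙ gx and gx ∙ x ≈ h amounts to extracting the square
  -- roots of h, h, g ∙ h and g ⁻¹ ∙ h.
  Unroot : Carrier → Carrier → Carrier → Set ℓ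
  Unroot g h x = (Unsquare h x × Unsquare h (g ∙ x)) × (Unsquare (g ∙ h) (g ∙ x) × Unsquare (g ⁻¹ ∙ h) x)

  unroot-cofinite : ∀ g h → Cofinite (Unroot g h)
  unroot-cofinite g h = cofinite-×
    (cofinite-× (unsquare-cofinite h) (cofinite-∙ g (unsquare-cofinite h)))
    (cofinite-× (cofinite-∙ g (unsquare-cofinite (g ∙ h))) (unsquare-cofinite (g ⁻¹ ∙ h)))

  Tame : Carrier → Carrier → Carrier → Carrier → Set (c ⊔ ℓ)
  Tame g h y z = y ∙ z ≈ h → Trivial g h

  module _ {g x : Carrier} where

    tame-xx : ∀ {h} → Unroot g h x → Tame g h x x
    tame-xx ((sq , _) , _) eq = here (sq eq)

    tame-gxgx : ∀ {h} → Unroot g h x → Tame g h (g ∙ x) (g ∙ x)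
    tame-gxgx ((_ , sq) , _) eq = here (sq eq)

    tame-xgx : ∀ {h} → Unroot g h x → Tame g h x (g ∙ x)
    tame-xgx {h} (_ , sq , _) eq =
      there (there (here (inverseʳ-unique g h (sq (trans (assoc g x (g ∙ x)) (∙-congˡ eq))))))

    tame-gxx : ∀ {h} → Unroot g h x → Tame g h (g ∙ x) x
    tame-gxx {h} (_ , _ , sq) eq = there (here (trans
      (inverseʳ-unique (g ⁻¹) h (sq (y≈x\\z g (x ∙ x) h (trans (sym (assoc g x x)) eq))))
      (⁻¹-involutive g)))

    tame-⁻¹⁻¹ : ∀ {h y z} → Tame g (h ⁻¹) z y → Tame g h (y ⁻¹) (z ⁻¹)
    tame-⁻¹⁻¹ {h} {y} {z} tame eq = trivial-⁻¹ (tame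
      (sym (⁻¹-selfInverse (trans (⁻¹-anti-homo-∙ z y) eq))))

    -- Of the sixteen products, eight reduce to square roots (those of two inverses after inverting,
    -- hence the conditions at `h ⁻¹`), six are identically `ε`, `g` or `g ⁻¹`, and two are
    -- `x⁻¹ g x` and its inverse.
    block-tame : ∀ {h} → Unroot g h x → Unroot g (h ⁻¹) x → Unconjugate g x h → Unconjugate g x (h ⁻¹) →
                 All (λ y → All (Tame g h y) (block g x)) (block g x)
    block-tame {h} r r⁻¹ u u⁻¹ =
        (tame-xx r ∷ tame-xgx r ∷ isε (inverseʳ x)
          ∷ (λ eq → there (there (here (trans (sym eq)
              (trans (∙-congˡ (⁻¹-anti-homo-∙ g x)) (\\-leftDividesˡ x (g ⁻¹))))))) ∷ [])
      ∷ (tame-gxx r ∷ tame-gxgx r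
          ∷ (λ eq → there (here (trans (sym eq) (//-rightDividesʳ x g))))
          ∷ isε (inverseʳ (g ∙ x)) ∷ [])
      ∷ (isε (inverseˡ x) ∷ (λ eq → there (here (u eq)))
          ∷ tame-⁻¹⁻¹ (tame-xx r⁻¹) ∷ tame-⁻¹⁻¹ (tame-gxx r⁻¹) ∷ [])
      ∷ ((λ eq → trivial-⁻¹ (there (here (u⁻¹
              (trans (sym (⁻¹-anti-homo-\\ (g ∙ x) x)) (⁻¹-cong eq))))))
          ∷ isε (inverseˡ (g ∙ x)) ∷ tame-⁻¹⁻¹ (tame-xgx r⁻¹) ∷ tame-⁻¹⁻¹ (tame-gxgx r⁻¹) ∷ [])
      ∷ []
      where
      isε : ∀ {y z} → y ∙ z ≈ ε → Tame g h y z
      isε yz≈ε eq = here (trans (sym eq) yz≈ε)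

  -- Generic points

  record Generic (P H : List Carrier) (g x : Carrier) : Set (c ⊔ ℓ) where
    field
      apart : ∀ {y z h} → y ∈ block g x → z ∈ P → h ∈ H → ¬ (y ∙ z ≈ h) × ¬ (z ∙ y ≈ h)
      tame  : ∀ {y z h} → y ∈ block g x → z ∈ block g x → h ∈ H → Tame g h y z

  ApartBlock : List Carrier → List Carrier → Carrier → Carrier → Set (c ⊔ ℓ)
  ApartBlock P H g x =
    (Apart P H x × Apart P H (g ∙ x)) × (Apart P H (x ⁻¹) × Apart P H ((g ∙ x) ⁻¹))

  apartBlock-cofinite : ∀ P H g → Cofinite (ApartBlock P H g)
  apartBlock-cofinite P H g = cofinite-×
    (cofinite-× apart (cofinite-∙ g apart))
    (cofinite-× (cofinite-⁻¹ apart) (cofinite-∙ g (cofinite-⁻¹ apart)))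
    where
    apart : Cofinite (Apart P H)
    apart = apart-cofinite P H

  toGeneric : ∀ {P H g x} → ApartBlock P H g x →
              All (λ h → Unroot g h x) (H ++ map _⁻¹ H) → All (Unconjugate g x) (H ++ map _⁻¹ H) →
              Generic P H g x
  toGeneric {P} {H} {g} {x} ((p , q) , (r , s)) unroot unconj = record { apart = apart ; tame = tame }
    where
    apart-block : All (Apart P H) (block g x)
    apart-block = p ∷ q ∷ r ∷ s ∷ []

    apart : ∀ {y z h} → y ∈ block g x → z ∈ P → h ∈ H → ¬ (y ∙ z ≈ h) × ¬ (z ∙ y ≈ h)
    apart y∈ z∈ h∈ =
      let a , y≈ = All.lookupAny apart-block y∈
          b , h≈ = All.lookupAny a h∈
          (yz≉h , zy≉h) , z≈ = All.lookupAny b z∈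
      in (λ eq → yz≉h (trans (∙-cong (sym y≈) (sym z≈)) (trans eq h≈)))
         , (λ eq → zy≉h (trans (∙-cong (sym z≈) (sym y≈)) (trans eq h≈)))

    tame : ∀ {y z h} → y ∈ block g x → z ∈ block g x → h ∈ H → Tame g h y z
    tame y∈ z∈ h∈ eq =
      let r   , h≈ = All.lookupAny (All.++⁻ˡ H unroot) h∈
          r⁻¹ , _  = All.lookupAny (All.map⁻ (All.++⁻ʳ H unroot)) h∈
          u   , _  = All.lookupAny (All.++⁻ˡ H unconj) h∈
          u⁻¹ , _  = All.lookupAny (All.map⁻ (All.++⁻ʳ H unconj)) h∈
          a   , y≈ = All.lookupAny (block-tame r r⁻¹ u u⁻¹) y∈
          b   , z≈ = All.lookupAny a z∈
      in ∈-resp (sym h≈) (b (trans (∙-cong (sym y≈) (sym z≈)) (trans eq h≈)))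

  abstract
    generic : ∀ P H g → Σ Carrier (Generic P H g)
    generic P H g =
      -- The cofinite conditions are first gathered into one list `F`: the conjugation condition
      -- need not be cofinite, so its point is chosen last, outside `F`.
      let F , avoids = cofinite-× (apartBlock-cofinite P H g)
                         (cofinite-All (unroot-cofinite g) (H ++ map _⁻¹ H))
          x , x∉F , unconj = fresh-unconjugate g (H ++ map _⁻¹ H) F
          apart , unroot = avoids x∉F
      in x , toGeneric apart unroot unconj

  -- The construction by stages

  include : ∀ {p} {P : Set p} → Dec P → List Carrier → List Carrier
  include (yes _) xs = xs
  include (no _)  xs = []

  ∈-include⁺ : ∀ {p} {P : Set p} (P? : Dec P) {y xs} → P → y ∈ xs → y ∈ include P? xs
  ∈-include⁺ (yes _) p y∈ = y∈
  ∈-include⁺ (no ¬p) p y∈ = contradiction p ¬p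

  ∈-include⁻ : ∀ {p} {P : Set p} (P? : Dec P) {y xs} → y ∈ include P? xs → P × y ∈ xs
  ∈-include⁻ (yes p) y∈ = p , y∈

  default-ε : ∀ {p} {P : Set p} → Dec P → Carrier → Carrier
  default-ε (yes _) y = y
  default-ε (no _)  y = ε

  level : ℕ → ℕ
  level t = proj₁ (schedule t)

  candidate : ℕ → Carrier
  candidate t = e (proj₂ (schedule t))

  -- A candidate missing from the required list is replaced by `ε`, so every stage yields a block;
  -- the recurring schedule gives the candidate further chances.
  pick : (ℕ → List Carrier) → ℕ → Carrier
  pick M t = default-ε (candidate t ∈? M (suc (level t))) (candidate t)

  mkBlock : (ℕ → List Carrier) → ℕ → List Carrier
  mkBlock M t = block (pick M t) (proj₁ (generic (M 0) (initial t) (pick M t)))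

  -- The finite part of `D k` built before stage `t`. All depths grow together: the new point is
  -- generic over `L t 0`, while its target comes from depth `suc (level t)`.
  L : ℕ → ℕ → List Carrier
  L zero    k = ε ∷ []
  L (suc t) k = include (k ≤? level t) (mkBlock (L t) t) ++ L t k

  B : ℕ → List Carrier
  B t = mkBlock (L t) t

  target : ℕ → Carrier
  target t = pick (L t) t

  point : ℕ → Carrier
  point t = proj₁ (generic (L t 0) (initial t) (target t))

  module Stage t = Generic (proj₂ (generic (L t 0) (initial t) (target t)))

  L-suc⁺ : ∀ {t k y} → k ≤ level t → y ∈ B t → y ∈ L (suc t) k
  L-suc⁺ {t} {k} k≤ y∈ = Any.++⁺ˡ (∈-include⁺ (k ≤? level t) k≤ y∈)

  L-suc⁻ : ∀ t {k y} → y ∈ L (suc t) k → (k ≤ level t × y ∈ B t) ⊎ y ∈ L t k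
  L-suc⁻ t {k} y∈ with Any.++⁻ (include (k ≤? level t) (B t)) y∈
  ... | inj₁ y∈B = inj₁ (∈-include⁻ (k ≤? level t) y∈B)
  ... | inj₂ y∈L = inj₂ y∈L

  L-step : ∀ {t k y} → y ∈ L t k → y ∈ L (suc t) k
  L-step {t} {k} = Any.++⁺ʳ (include (k ≤? level t) (B t))

  L-mono : ∀ {s t k y} → s ≤ t → y ∈ L s k → y ∈ L t k
  L-mono {t = zero}  s≤t y∈ = P.subst (λ s → _ ∈ L s _) (n≤0⇒n≡0 s≤t) y∈
  L-mono {t = suc t} s≤t y∈ with m≤n⇒m<n∨m≡n s≤t
  ... | inj₁ (s≤s s≤t′) = L-step {t} (L-mono s≤t′ y∈)
  ... | inj₂ P.refl     = y∈

  L-anti : ∀ t {j k y} → j ≤ k → y ∈ L t k → y ∈ L t j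
  L-anti zero    j≤k y∈ = y∈
  L-anti (suc t) j≤k y∈ with L-suc⁻ t y∈
  ... | inj₁ (k≤ , y∈B) = L-suc⁺ {t} (≤-trans j≤k k≤) y∈B
  ... | inj₂ y∈L        = L-step {t} (L-anti t j≤k y∈L)

  L-⁻¹ : ∀ t {k y} → y ∈ L t k → y ⁻¹ ∈ L t k
  L-⁻¹ zero    (here eq) = here (trans (⁻¹-cong eq) ε⁻¹≈ε)
  L-⁻¹ (suc t) y∈ with L-suc⁻ t y∈
  ... | inj₁ (k≤ , y∈B) = L-suc⁺ {t} k≤ (block-⁻¹ y∈B)
  ... | inj₂ y∈L        = L-step {t} (L-⁻¹ t y∈L)

  ε∈L : ∀ t {k} → ε ∈ L t k
  ε∈L t = L-mono {0} {t} z≤n (here refl)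

  L-split : ∀ m t {k y} → y ∈ L t k → y ∈ L m k ⊎ ∃ λ r → m ≤ r × k ≤ level r × y ∈ B r
  L-split m zero    y∈ = inj₁ (L-mono {0} {m} z≤n y∈)
  L-split m (suc t) y∈ with L-suc⁻ t y∈
  ... | inj₂ y∈L = L-split m t y∈L
  ... | inj₁ (k≤ , y∈B) with <-cmp t m
  ...   | tri< t<m _ _ = inj₁ (L-mono t<m (L-suc⁺ {t} k≤ y∈B))
  ...   | tri≈ _ t≡m _ = inj₂ (t , ≤-reflexive (P.sym t≡m) , k≤ , y∈B)
  ...   | tri> _ _ m<t = inj₂ (t , ≤-trans (n≤1+n m) m<t , k≤ , y∈B)

  default-ε-∈ : ∀ {a xs} → ε ∈ xs → (a∈? : Dec (a ∈ xs)) → default-ε a∈? a ∈ xs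
  default-ε-∈ ε∈ (yes a∈) = a∈
  default-ε-∈ ε∈ (no _)   = ε∈

  default-ε-yes : ∀ {p} {P : Set p} {a} → P → (P? : Dec P) → default-ε P? a ≡ a
  default-ε-yes p (yes _) = P.refl
  default-ε-yes p (no ¬p) = contradiction p ¬p

  target∈L : ∀ t → target t ∈ L t (suc (level t))
  target∈L t = default-ε-∈ (ε∈L t) (candidate t ∈? L t (suc (level t)))

  -- Targets sit at least one depth beyond the level of their block; this is the source of the shift
  -- from `k` to `suc k`.
  trivial∈L : ∀ {t h} → Trivial (target t) h → h ∈ L t (suc (level t))
  trivial∈L {t} (here eq)                 = ∈-resp (sym eq) (ε∈L t)
  trivial∈L {t} (there (here eq))         = ∈-resp (sym eq) (target∈L t)
  trivial∈L {t} (there (there (here eq))) = ∈-resp (sym eq) (L-⁻¹ t (target∈L t))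

  target-recurs : ∀ {s k h} → h ∈ L s (suc k) → ∀ N →
                  ∃ λ t → N ≤ t × level t ≡ k × target t ≈ h
  -- From stage `s` on, `h` is already listed, so the candidate passes the test in `pick`.
  target-recurs {s} {k} {h} h∈ N with schedule-recurs (k , index h) (s ⊔ℕ N)
  ... | t , s⊔N≤t , eq = t , ≤-trans (m≤n⊔m s N) s⊔N≤t , P.cong proj₁ eq , trans
    (reflexive (default-ε-yes candidate∈ (candidate t ∈? L t (suc (level t))))) candidate≈h
    where
    candidate≈h : candidate t ≈ h
    candidate≈h = trans (reflexive (P.cong (e ∘ proj₂) eq)) (e-index h)
    candidate∈ : candidate t ∈ L t (suc (level t))
    candidate∈ = ∈-resp (sym candidate≈h) (P.subst (λ j → h ∈ L t (suc j)) (P.sym (P.cong proj₁ eq))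
      (L-mono (≤-trans (m≤m⊔n s N) s⊔N≤t) h∈))

  -- With `ε` as the earlier factor, `apart` keeps the block off the first `t` elements of the
  -- enumeration.
  B-new : ∀ {t y} → y ∈ B t → t ≤ index y
  B-new {t} {y} y∈ with <-cmp (index y) t
  ... | tri< i<t _ _ = ⊥-elim (proj₁ (Stage.apart t y∈ (ε∈L t) (∈-initial i<t)) (identityʳ y))
  ... | tri≈ _ i≡t _ = ≤-reflexive (P.sym i≡t)
  ... | tri> _ _ t<i = ≤-trans (n≤1+n t) t<i

  -- The sets `D k` and their images under `Δ`

  D : ℕ → SubsetG
  D k y = ∃ λ t → y ∈ L t k

  D-resp : ∀ {k} → Respects≈ (D k)
  D-resp x≈y (t , x∈) = t , ∈-resp x≈y x∈

  -- By `B-new`, no block from stage `suc (index y)` on contains `y`, so membership in the infinite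
  -- union is a finite search.
  D-bounded : ∀ {k y} → D k y → y ∈ L (suc (index y)) k
  D-bounded {k} {y} (t , y∈) with L-split (suc (index y)) t y∈
  ... | inj₁ y∈L             = y∈L
  ... | inj₂ (r , i<r , _ , y∈B) = ⊥-elim (<-irrefl P.refl (≤-trans i<r (B-new y∈B)))

  D? : ∀ k y → Dec (D k y)
  D? k y = map′ (_ ,_) D-bounded (y ∈? L (suc (index y)) k)

  -- Suppose `x` lies in a block past `index h`. If `z` is older or newer, the newer factor is
  -- generic over the other and over `h`, which excludes the product `h`. In a common block, `h` is
  -- trivial and so lies deeper.
  product∈D : ∀ {k s t x z h} → x ∈ L t k → z ∈ L s k → x ∙ z ≈ h →
              x ∈ L (suc (index h)) k ⊎ D (suc k) h
  product∈D {k} {s} {t} {x} {z} {h} x∈ z∈ eq with L-split (suc (index h)) t x∈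
  ... | inj₁ x∈L = inj₁ x∈L
  ... | inj₂ (r , i<r , k≤r , x∈B) with L-split r s z∈
  ...   | inj₁ z∈L = ⊥-elim (proj₁ (Stage.apart r x∈B (L-anti r z≤n z∈L) (∈-initial i<r)) eq)
  ...   | inj₂ (q , r≤q , k≤q , z∈B) with m≤n⇒m<n∨m≡n r≤q
  ...     | inj₁ r<q = ⊥-elim (proj₂ (Stage.apart q z∈B
              (L-mono r<q (L-suc⁺ {r} z≤n x∈B)) (∈-initial (≤-trans i<r r≤q))) eq)
  ...     | inj₂ P.refl = inj₂ (r , L-anti r (s≤s k≤r)
              (trivial∈L {r} (Stage.tame r x∈B z∈B (∈-initial i<r) eq)))

  ΔD⊆D : ∀ k → Δ (D k) ⊆ D (suc k)
  -- Infinitude is only a negation, so decidability of `D (suc k)` is what permits contradiction: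
  -- for `h` outside it, one finite list covers the intersection.
  ΔD⊆D k h infinite = decidable-stable (D? (suc k) h) λ h∉D →
    infinite (L (suc (index h)) k , λ x (( s , z∈) , (t , x∈)) →
      case h∉D (product∈D {s = s} {t} x∈ (L-⁻¹ s z∈) (cancel x)))
    where
    case : ∀ {a b} {A : Set a} {B : Set b} → ¬ B → A ⊎ B → A
    case ¬b (inj₁ a) = a
    case ¬b (inj₂ b) = contradiction b ¬b
    cancel : ∀ x → x ∙ (h ⁻¹ ∙ x) ⁻¹ ≈ h
    cancel x = trans (∙-congˡ (⁻¹-anti-homo-\\ h x)) (\\-leftDividesˡ x h)

  -- A stage `t ≥ bound xs` with target `h` defeats the list `xs`: `g ∙ x` belongs to the
  -- intersection, yet its index is at least `t`.
  D⊆ΔD : ∀ k → D (suc k) ⊆ Δ (D k)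
  D⊆ΔD k h (s , h∈) (xs , covers) with target-recurs {s} h∈ (bound xs)
  ... | t , N≤t , P.refl , g≈h = <-irrefl P.refl (≤-trans (index<bound gx∈xs) (≤-trans N≤t (B-new (there (here refl)))))
    where
    x g : Carrier
    x = point t
    g = target t
    in-D : ∀ {y} → y ∈ B t → D k y
    in-D y∈ = suc t , L-suc⁺ {t} ≤-refl y∈
    gx∈xs : g ∙ x ∈ xs
    gx∈xs = covers (g ∙ x)
      ( D-resp {k} (trans (sym (\\-leftDividesʳ g x)) (∙-congʳ (⁻¹-cong g≈h))) (in-D (here refl))
      , in-D (there (here refl)))

  D-decreasing : ∀ k → D (suc k) ⊆ D k
  D-decreasing k y (t , y∈) = t , L-anti t (n≤1+n k) y∈

  -- The witness is the point of a stage of level exactly `k`. Were it also in the older list or in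
  -- a newer block, `x ∙ x ⁻¹ ≈ ε` would be a product forbidden by the newer stage.
  D-strict : ∀ k → D (suc k) ⊊ D k
  -- Only the level matters, so candidate `0` is arbitrary; the bound puts `ε` among the first `t`
  -- elements.
  D-strict k with schedule-recurs (k , 0) (suc (index ε))
  ... | t , ε<t , eq = D-decreasing k , point t
      , (suc t , L-suc⁺ {t} (≤-reflexive (P.sym level≡k)) x∈B)
      , not-deeper
    where
    level≡k : level t ≡ k
    level≡k = P.cong proj₁ eq
    x∈B : point t ∈ B t
    x∈B = here refl
    not-deeper : ¬ D (suc k) (point t)
    not-deeper (s , x∈) with L-split t s x∈
    ... | inj₁ x∈L = proj₁ (Stage.apart t x∈B (L-⁻¹ t (L-anti t z≤n x∈L)) (∈-initial ε<t)) (inverseʳ _)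
    ... | inj₂ (r , t≤r , k<r , x∈Br) with m≤n⇒m<n∨m≡n t≤r
    ...   | inj₁ t<r = proj₁ (Stage.apart r x∈Br (L-mono t<r (L-suc⁺ {t} z≤n (block-⁻¹ x∈B)))
              (∈-initial (≤-trans ε<t t≤r))) (inverseʳ _)
    ...   | inj₂ P.refl = <-irrefl (P.sym level≡k) k<r

  -- Iterating `Δ` from `D 0`

  Δ-mono : ∀ {A A′} → A ⊆ A′ → Δ A ⊆ Δ A′
  Δ-mono A⊆A′ g infinite (xs , covers) =
    infinite (xs , λ x (u , v) → covers x (A⊆A′ _ u , A⊆A′ _ v))

  -- Sets are predicates compared by inclusion, so `Δ (D k) = D (suc k)` is iterated one inclusion
  -- at a time, through monotonicity of `Δ`.
  Δ^⊆D : ∀ k → Δ^ k (D 0) ⊆ D k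
  Δ^⊆D zero    x x∈ = x∈
  Δ^⊆D (suc k) x x∈ = ΔD⊆D k x (Δ-mono (Δ^⊆D k) x x∈)

  D⊆Δ^ : ∀ k → D k ⊆ Δ^ k (D 0)
  D⊆Δ^ zero    x x∈ = x∈
  D⊆Δ^ (suc k) x x∈ = Δ-mono (D⊆Δ^ k) x (D⊆ΔD k x x∈)

  Δ^-strict : ∀ k → Δ^ (suc k) (D 0) ⊊ Δ^ k (D 0)
  Δ^-strict k with D-strict k
  ... | sub , x , x∈ , x∉ =
    (λ y y∈ → D⊆Δ^ k y (sub y (Δ^⊆D (suc k) y y∈)))
    , x , D⊆Δ^ k x x∈ , x∉ ∘ Δ^⊆D (suc k) x

theorem5p4 : {c ℓ : Level} (G : Group c ℓ)
    → GroupDefs.CountablyInfinite G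
    → GroupDefs.FiniteSquareRoots G
    → Σ (GroupDefs.SubsetG G) λ A
    → GroupDefs.Respects≈ G A
    × ((k : ℕ) → GroupDefs._⊊_ G (GroupDefs.Δ^ G (suc k) A) (GroupDefs.Δ^ G k A))
theorem5p4 G enum roots = D 0 , D-resp {0} , Δ^-strict
  where open Construction G enum roots
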